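{- Let $n\geq 6$ be an integer with $n\not\equiv 1 \pmod 4$. Then $C_n^2$, the square of the cycle of order $n$, is irreducible, with $\tau\left(C_n^2\right)=3$.
   Context: Graphs are finite, simple and undirected; $d_G(x,y)$ is the distance between $x$ and $y$ in $G$. A vertex $w$ resolves a pair of vertices $u,v$ if $d_G(u,w)\neq d_G(v,w)$. A set $W\subseteq V(G)$ is a resolving set for $G$ if every pair of distinct vertices of $G$ is resolved by some vertex of $W$. The metric dimension $\beta(G)$ is the minimum cardinality of a resolving set for $G$ (with $\beta(K_1)=0$). The threshold dimension is $\tau(G)=\min\{\beta(H): H \text{ contains } G \text{ as a spanning subgraph}\}$, i.e. the minimum metric dimension among all graphs $H$ with $V(H)=V(G)$ and $E(G)\subseteq E(H)$. A graph $G$ is irreducible if $\tau(G)=\beta(G)$. The square $G^2$ of a graph $G$ is the graph with vertex set $V(G)$ in which two distinct vertices $u,v$ are adjacent if and only if $d_G(u,v)\leq 2$. $C_n$ is the cycle on $n$ vertices. -}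

module Defs where

open import Data.Empty using (⊥)
open import Data.Fin using (Fin; toℕ)
open import Data.Fin.Properties using (any?)
import Data.Fin.Properties as Fin
open import Data.Fin.Subset using (Subset; _∈_; ∣_∣)
open import Data.Maybe using (Maybe; just; nothing)
open import Data.Nat using (ℕ; zero; suc; _≤_; _<_; s≤s; s≤s⁻¹)
open import Data.Nat.Properties using (_≟_; ≮⇒≥; ≤⇒≯; anyUpTo?; allUpTo?; 1+n≢n)
open import Data.Product using (∃; ∃₂; ∃-syntax; _×_; _,_)
open import Data.Sum using (_⊎_; inj₁; inj₂; [_,_]; swap)
open import Function using (_∘_)
open import Level using (0ℓ)
open import Relation.Binary.Core using (Rel)
open import Relation.Binary.Definitions using (Decidable; Symmetric)
open import Relation.Binary.PropositionalEquality
  using (_≡_; _≢_; refl; sym; trans; cong)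
open import Relation.Nullary using (¬_; Dec; yes; no; ¬?)
open import Relation.Nullary.Decidable using (map′; _×-dec_; _⊎-dec_)
import Relation.Unary as U

Least : (ℕ → Set) → ℕ → Set
Least P m = P m × (∀ {k} → P k → m ≤ k)

least? : ∀ {P : ℕ → Set} → U.Decidable P → U.Decidable (Least P)
least? {P} P? m = map′ to from (P? m ×-dec allUpTo? (¬? ∘ P?) m)
  where
  to : P m × (∀ {k} → k < m → ¬ P k) → Least P m
  to (p , below) = p , λ pk → ≮⇒≥ λ k<m → below k<m pk

  from : Least P m → P m × (∀ {k} → k < m → ¬ P k)
  from (p , least) = p , λ k<m pk → ≤⇒≯ (least pk) k<m

record Graph (n : ℕ) : Set₁ where
  field
    Adj   : Rel (Fin n) 0ℓ
    adj?  : Decidable Adj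
    symm  : Symmetric Adj
    irrefl : ∀ {u} → ¬ Adj u u

open Graph public using (Adj)

-- G and H have the same vertex set, so every subgraph inclusion is spanning.
_⊆ᴳ_ : ∀ {n} → Graph n → Graph n → Set
G ⊆ᴳ H = ∀ {u v} → Adj G u v → Adj H u v

module _ {n : ℕ} (G : Graph n) where
  open Graph G hiding (Adj)

  data Walk : Fin n → Fin n → ℕ → Set where
    []  : ∀ {u} → Walk u u 0
    _∷_ : ∀ {u v w k} → Adj G u v → Walk v w k → Walk u w (suc k)

  -- The distance from u to v is d; `nothing` stands for ∞ (u and v in different
  -- components).
  data Distance (u v : Fin n) : Maybe ℕ → Set where
    finite   : ∀ {k} → Least (Walk u v) k → Distance u v (just k)
    infinite : (∀ k → ¬ Walk u v k) → Distance u v nothing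

  Resolves : Fin n → Fin n → Fin n → Set
  Resolves w u v =
    ∃₂ λ d e → Distance u w d × Distance v w e × d ≢ e

  Resolving : Subset n → Set
  Resolving W = ∀ {u v} → u ≢ v → ∃[ w ] (w ∈ W × Resolves w u v)

  MetricDimension : ℕ → Set
  MetricDimension = Least λ k → ∃[ W ] (Resolving W × ∣ W ∣ ≡ k)

  walk? : ∀ u v → U.Decidable (Walk u v)
  walk? u v zero = map′ (λ { refl → [] }) (λ { [] → refl }) (u Fin.≟ v)
  walk? u w (suc k) =
    map′ (λ { (_ , a , p) → a ∷ p }) (λ { (a ∷ p) → _ , a , p })
      (any? λ v → adj? u v ×-dec walk? v w k)

  _∷ʳ_ : ∀ {u v w k} → Walk u v k → Adj G v w → Walk u w (suc k)
  []      ∷ʳ b = b ∷ []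
  (a ∷ p) ∷ʳ b = a ∷ (p ∷ʳ b)

  reverse : ∀ {u v k} → Walk u v k → Walk v u k
  reverse []      = []
  reverse (a ∷ p) = reverse p ∷ʳ symm a

  distance-sym : ∀ {u v d} → Distance u v d → Distance v u d
  distance-sym (finite (p , least)) = finite (reverse p , least ∘ reverse)
  distance-sym (infinite none)      = infinite λ k → none k ∘ reverse

  distance? : ∀ u v k → Dec (Distance u v (just k))
  distance? u v k = map′ finite (λ { (finite l) → l }) (least? (walk? u v) k)

  DistanceAtMost : ℕ → Rel (Fin n) 0ℓ
  DistanceAtMost r u v = ∃[ k ] (k ≤ r × Distance u v (just k))

  distanceAtMost? : ∀ r → Decidable (DistanceAtMost r)
  distanceAtMost? r u v =
    map′ (λ { (k , k<1+r , d) → k , s≤s⁻¹ k<1+r , d })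
         (λ { (k , k≤r , d) → k , s≤s k≤r , d })
      (anyUpTo? (distance? u v) (suc r))

  square : Graph n
  square = record
    { Adj    = λ u v → u ≢ v × DistanceAtMost 2 u v
    ; adj?   = λ u v → ¬? (u Fin.≟ v) ×-dec distanceAtMost? 2 u v
    ; symm   = λ { (u≢v , k , k≤2 , d) → u≢v ∘ sym , k , k≤2 , distance-sym d }
    ; irrefl = λ { (u≢u , _) → u≢u refl }
    }

ThresholdDimension : ∀ {n} → Graph n → ℕ → Set₁
ThresholdDimension G t =
  (∃[ H ] (G ⊆ᴳ H × MetricDimension H t)) ×
  (∀ H {k} → G ⊆ᴳ H → MetricDimension H k → t ≤ k)

Irreducible : ∀ {n} → Graph n → Set₁
Irreducible G = ∃[ k ] (ThresholdDimension G k × MetricDimension G k)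

-- v follows u in the cyclic order 0, 1, …, n - 1, 0.
Follows : ∀ {n} → Rel (Fin n) 0ℓ
Follows {n} u v = suc (toℕ u) ≡ toℕ v ⊎ (suc (toℕ u) ≡ n × toℕ v ≡ 0)

follows? : ∀ {n} → Decidable (Follows {n})
follows? {n} u v =
  (suc (toℕ u) ≟ toℕ v) ⊎-dec ((suc (toℕ u) ≟ n) ×-dec (toℕ v ≟ 0))

follows-irrefl : ∀ {n} → 3 ≤ n → {u : Fin n} → ¬ Follows u u
follows-irrefl _   (inj₁ 1+u≡u)         = 1+n≢n 1+u≡u
follows-irrefl 3≤n (inj₂ (1+u≡n , u≡0)) =
  absurd 3≤n (trans (sym 1+u≡n) (cong suc u≡0))
  where
  absurd : ∀ {m} → 3 ≤ m → m ≡ 1 → ⊥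
  absurd (s≤s ()) refl

cycle : ∀ n → 3 ≤ n → Graph n
cycle n 3≤n = record
  { Adj    = λ u v → Follows u v ⊎ Follows v u
  ; adj?   = λ u v → follows? u v ⊎-dec follows? v u
  ; symm   = swap
  ; irrefl = [ follows-irrefl 3≤n , follows-irrefl 3≤n ]
  }

{-# OPTIONS --safe #-}
-- Lower bound: if {a, b} resolves a graph H, then the neighbours of a are told
-- apart by their distances to b alone, and these lie in {D - 1, D, D + 1} with
-- D = d(a, b); so a has at most three neighbours.  But every vertex of C_n²,
-- and hence of any H containing it, has at least four.
--
-- Upper bound: {0, 1, 2} resolves C_n².  For a vertex 2 + x, put y = n - 2 - x,
-- p = ⌈x/2⌉ and q = ⌈y/2⌉; its distances to 0, 1, 2 are (p + 1) ⊓ q,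
-- ⌈(x+1)/2⌉ ⊓ ⌈(y+1)/2⌉ and p ⊓ (q + 1).  The first and the third decide which
-- of p, q is smaller, and unless p = q the second then recovers x or y.  If
-- p = q, two vertices with equal distances exist only when n = 4p + 1.
module Submission where

open import Defs
open import Data.Fin as Fin using (Fin; zero; suc; toℕ; fromℕ<)
open import Data.Fin.Patterns using (0F; 1F; 2F)
open import Data.Fin.Properties
  using (toℕ<n; toℕ-fromℕ; toℕ-inject₁; toℕ-injective; toℕ-fromℕ<; fromℕ<-injective; injective⇒≤)
open import Data.Fin.Subset using (Subset; _∈_; ∣_∣; inside) renaming (_-_ to _∖_)
import Data.Fin.Subset as Subset
open import Data.Fin.Subset.Properties
  using (nonempty?; ∣p─q∣≤∣p∣; x∈p∧x≢y⇒x∈p-y; x∈p⇒∣p-x∣<∣p∣; Empty-unique; ∣⊥∣≡0)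
open import Data.Maybe using (just)
open import Data.Maybe.Properties using (just-injective)
open import Data.Nat
open import Data.Nat.Divisibility using (_∣_; divides-refl; >⇒∤)
open import Data.Nat.DivMod using ([m+kn]%n≡m%n)
open import Data.Nat.Properties
open import Data.Nat.Solver using (module +-*-Solver)
open import Data.Product using (∃; ∃₂; ∃-syntax; _×_; _,_; proj₁; proj₂)
open import Data.Sum as Sum using (_⊎_; inj₁; inj₂)
open import Data.Vec using ([]; _∷_; here; there; lookup)
open import Data.Vec.Relation.Unary.All as All using (All; []; _∷_)
import Data.Vec.Relation.Unary.All.Properties as All
open import Data.Vec.Relation.Unary.AllPairs using ([]; _∷_)
open import Data.Vec.Relation.Unary.Unique.Propositional using (Unique)
open import Data.Vec.Relation.Unary.Unique.Propositional.Properties using (lookup-injective)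
open import Function using (_∘_; id)
open import Function.Definitions using (Injective)
open import Relation.Binary.Definitions using (tri<; tri≈; tri>)
open import Relation.Binary.PropositionalEquality
  using (_≡_; _≢_; refl; sym; trans; cong; cong₂; subst; module ≡-Reasoning)
open import Relation.Nullary using (¬_; Dec; yes; no; contradiction)
import Relation.Unary as U

-- Distances in graphs

least-below : ∀ {P : ℕ → Set} → U.Decidable P → ∀ k → P k → ∃[ j ] (j ≤ k × Least P j)
least-below P? k pk with P? 0
... | yes p₀ = 0 , z≤n , p₀ , λ _ → z≤n
least-below P? zero    pk | no ¬p₀ = contradiction pk ¬p₀
least-below {P} P? (suc k) pk | no ¬p₀ =
  let j , j≤k , pj , least = least-below (P? ∘ suc) k pk
      least⁺ : ∀ {m} → P m → suc j ≤ m
      least⁺ = λ { {zero} p₀ → contradiction p₀ ¬p₀ ; {suc m} pm → s≤s (least pm) }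
  in suc j , s≤s j≤k , pj , least⁺

module _ {n} (G : Graph n) where
  open Graph G using (symm; irrefl)

  walk⇒distance : ∀ {u v k} → Walk G u v k → ∃[ j ] (j ≤ k × Distance G u v (just j))
  walk⇒distance {u} {v} {k} p =
    let j , j≤k , l = least-below (walk? G u v) k p in j , j≤k , finite l

  distance-unique : ∀ {u v d e} → Distance G u v d → Distance G u v e → d ≡ e
  distance-unique (finite (p , l)) (finite (q , m)) = cong just (≤-antisym (l q) (m p))
  distance-unique (finite (p , _)) (infinite none)  = contradiction p (none _)
  distance-unique (infinite none)  (finite (p , _)) = contradiction p (none _)
  distance-unique (infinite _)     (infinite _)     = refl

  adj⇒distance-1 : ∀ {u v} → Adj G u v → Distance G u v (just 1)
  adj⇒distance-1 {u} {v} a = finite (a ∷ [] , least)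
    where
    least : ∀ {k} → Walk G u v k → 1 ≤ k
    least []      = contradiction a irrefl
    least (_ ∷ _) = s≤s z≤n

  -- Two infinite distances are equal and resolve nothing, so at least one of the two is finite.
  -- This replaces any assumption of connectedness.
  walk-between-resolved : ∀ {u v w} → Resolves G w u v → ∃ (Walk G u w) ⊎ ∃ (Walk G v w)
  walk-between-resolved (_ , _ , finite (p , _) , _ , _) = inj₁ (_ , p)
  walk-between-resolved (_ , _ , infinite _ , finite (p , _) , _) = inj₂ (_ , p)
  walk-between-resolved (_ , _ , infinite _ , infinite _ , d≢e) = contradiction refl d≢e

  adj-distance-≤ : ∀ {u v w d e} → Adj G u v →
                   Distance G u w (just d) → Distance G v w (just e) → d ≤ suc e
  adj-distance-≤ a (finite (_ , least)) (finite (p , _)) = least (a ∷ p)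

  -- Only the inclusion of `W` in {a, b} is asked for, and `a` may equal `b`, so resolving sets with
  -- fewer than two elements are covered as well.
  two-landmarks⇒degree≤3 :
    ∀ {W} a b → (∀ {w} → w ∈ W → w ≡ a ⊎ w ≡ b) → Resolving G W →
    (v : Fin 4 → Fin n) → Injective _≡_ _≡_ v → ¬ (∀ i → Adj G a (v i))
  two-landmarks⇒degree≤3 {W} a b W⊆ab resolving v v-inj a~v =
    1+n≰n (injective⇒≤ {f = f} f-inj)
    where
    b-resolves : ∀ {i j} → i ≢ j → Resolves G b (v i) (v j)
    b-resolves {i} {j} i≢j with resolving (i≢j ∘ v-inj)
    ... | w , w∈W , res with W⊆ab w∈W
    ... | inj₂ refl = res
    ... | inj₁ refl = let d , e , dist , dist′ , d≢e = res in
      contradiction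
        (trans (distance-unique dist (adj⇒distance-1 (symm (a~v i))))
               (distance-unique (adj⇒distance-1 (symm (a~v j))) dist′))
        d≢e

    -- `b` is at finite distance from one of the first two neighbours, hence from `a`, hence from
    -- every neighbour of `a`.
    a-walk : ∃ (Walk G a b)
    a-walk with walk-between-resolved (b-resolves {0F} {1F} λ ())
    ... | inj₁ (_ , p) = _ , a~v 0F ∷ p
    ... | inj₂ (_ , p) = _ , a~v 1F ∷ p

    D : ℕ
    D = proj₁ (walk⇒distance (proj₂ a-walk))

    D-dist : Distance G a b (just D)
    D-dist = proj₂ (proj₂ (walk⇒distance (proj₂ a-walk)))

    v-distance : ∀ i → ∃[ j ] (j ≤ suc (proj₁ a-walk) × Distance G (v i) b (just j))
    v-distance i = walk⇒distance (symm (a~v i) ∷ proj₂ a-walk)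

    δ : Fin 4 → ℕ
    δ i = proj₁ (v-distance i)

    δ-dist : ∀ i → Distance G (v i) b (just (δ i))
    δ-dist i = proj₂ (proj₂ (v-distance i))

    δ-inj : ∀ {i j} → δ i ≡ δ j → i ≡ j
    δ-inj {i} {j} δi≡δj with i Fin.≟ j
    ... | yes i≡j = i≡j
    ... | no i≢j = let d , e , dist , dist′ , d≢e = b-resolves i≢j in
      contradiction
        (trans (distance-unique dist (δ-dist i))
          (trans (cong just δi≡δj) (distance-unique (δ-dist j) dist′)))
        d≢e

    D≤1+δ : ∀ i → D ≤ suc (δ i)
    D≤1+δ i = adj-distance-≤ (a~v i) D-dist (δ-dist i)

    1+δ∸D<3 : ∀ i → suc (δ i) ∸ D < 3
    1+δ∸D<3 i = s≤s (≤-trans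
      (∸-monoˡ-≤ D (s≤s (adj-distance-≤ (symm (a~v i)) (δ-dist i) D-dist)))
      (≤-reflexive (m+n∸n≡m 2 D)))

    -- The shift by one sends D - 1, D, D + 1 to 0, 1, 2. By `D≤1+δ` the subtraction never
    -- truncates, so `f` inherits injectivity from `δ`, against the pigeonhole principle.
    f : Fin 4 → Fin 3
    f i = fromℕ< (1+δ∸D<3 i)

    f-inj : Injective _≡_ _≡_ f
    f-inj {i} {j} fi≡fj = δ-inj (suc-injective
      (∸-cancelʳ-≡ (D≤1+δ i) (D≤1+δ j) (fromℕ<-injective _ _ (1+δ∸D<3 i) (1+δ∸D<3 j) fi≡fj)))

-- Small resolving sets and minimum degree

remove-one : ∀ {n} → Fin n → (W : Subset n) → ∀ {k} → ∣ W ∣ ≤ suc k → ∃[ a ] ∣ W ∖ a ∣ ≤ k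
remove-one {n} x W ∣W∣≤1+k with nonempty? W
... | yes (a , a∈W) = a , s≤s⁻¹ (≤-trans (x∈p⇒∣p-x∣<∣p∣ a∈W) ∣W∣≤1+k)
-- An empty `W` has nothing to remove; `x` serves as a dummy.
... | no W-empty = x , ≤-trans (∣p─q∣≤∣p∣ W Subset.⁅ x ⁆)
  (≤-trans (≤-reflexive (trans (cong ∣_∣ (Empty-unique W-empty)) (∣⊥∣≡0 n))) z≤n)

cover-by-two : ∀ {n} → Fin n → (W : Subset n) → ∣ W ∣ ≤ 2 →
               ∃₂ λ a b → ∀ {w} → w ∈ W → w ≡ a ⊎ w ≡ b
cover-by-two {n} x W ∣W∣≤2 with remove-one x W ∣W∣≤2
... | a , ∣W∖a∣≤1 with remove-one x (W ∖ a) ∣W∖a∣≤1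
... | b , ∣W∖ab∣≤0 = a , b , covered
  where
  covered : ∀ {w} → w ∈ W → w ≡ a ⊎ w ≡ b
  covered {w} w∈W with w Fin.≟ a | w Fin.≟ b
  ... | yes w≡a | _       = inj₁ w≡a
  ... | no _    | yes w≡b = inj₂ w≡b
  ... | no w≢a  | no w≢b  = contradiction
    (≤-trans (x∈p⇒∣p-x∣<∣p∣ (x∈p∧x≢y⇒x∈p-y (x∈p∧x≢y⇒x∈p-y w∈W w≢a) w≢b)) ∣W∖ab∣≤0)
    λ ()

-- Four neighbours are required at every vertex because the landmark `a` depends on the given `W`.
degree≥4⇒resolving≥3 :
  ∀ {n} (G : Graph n) → Fin n →
  (∀ a → ∃[ vs ] (Unique {n = 4} vs × All (Adj G a) vs)) →
  ∀ {W} → Resolving G W → 3 ≤ ∣ W ∣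
degree≥4⇒resolving≥3 G x neighbours {W} resolving = ≮⇒≥ λ ∣W∣<3 →
  let a , b , W⊆ab = cover-by-two x W (s≤s⁻¹ ∣W∣<3)
      vs , unique , adjacent = neighbours a
  in two-landmarks⇒degree≤3 G a b W⊆ab resolving (lookup vs)
       (λ {i} {j} → lookup-injective unique i j)
       (All.lookup⁺ adjacent)

-- Squares of graphs

module _ {n} (G : Graph n) where

  walk≤2⇒square-adj : ∀ {u v k} → u ≢ v → k ≤ 2 → Walk G u v k → Adj (square G) u v
  walk≤2⇒square-adj u≢v k≤2 p =
    let j , j≤k , d = walk⇒distance G p in u≢v , j , ≤-trans j≤k k≤2 , d

  infixr 5 _++_
  _++_ : ∀ {u v w k l} → Walk G u v k → Walk G v w l → Walk G u w (k + l)
  []      ++ q = q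
  (a ∷ p) ++ q = a ∷ (p ++ q)

  -- A step u → v is dropped when u = v, so the result may be shorter than ⌈k/2⌉.
  square-walk : ∀ {u v k} → Walk G u v k → ∃[ j ] (j ≤ ⌈ k /2⌉ × Walk (square G) u v j)
  square-walk [] = 0 , z≤n , []
  square-walk (_∷_ {u} {v} a []) =
    1 , ≤-refl , walk≤2⇒square-adj (λ { refl → Graph.irrefl G a }) (s≤s z≤n) (a ∷ []) ∷ []
  square-walk (_∷_ {u} a (_∷_ {v = v} b p)) with square-walk p | u Fin.≟ v
  ... | j , j≤ , q | yes refl = j , m≤n⇒m≤1+n j≤ , q
  ... | j , j≤ , q | no u≢v   =
    suc j , s≤s j≤ , walk≤2⇒square-adj u≢v ≤-refl (a ∷ b ∷ []) ∷ q

  -- Each edge of the square expands to at most two edges of `G`. The bound is put as `⌈ j /2⌉ ≤ k`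
  -- so that it chains with monotonicity of `⌈_/2⌉`.
  unsquare-walk : ∀ {u v k} → Walk (square G) u v k → ∃[ j ] (⌈ j /2⌉ ≤ k × Walk G u v j)
  unsquare-walk [] = 0 , z≤n , []
  unsquare-walk ((_ , i , i≤2 , finite (p , _)) ∷ q) =
    let j , j≤ , q′ = unsquare-walk q
    in i + j , ≤-trans (⌈n/2⌉-mono (+-monoˡ-≤ j i≤2)) (s≤s j≤) , p ++ q′

  -- Pairing the steps of a shortest walk gives the upper bound; expanding a walk of the square
  -- gives the lower one.
  square-distance : ∀ {u v d} → Distance G u v (just d) → Distance (square G) u v (just ⌈ d /2⌉)
  square-distance {u} {v} {d} (finite (p , least)) =
    let j , j≤ , q = square-walk p
    in finite (subst (Walk (square G) u v) (≤-antisym j≤ (lower q)) q , lower)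
    where
    lower : ∀ {k} → Walk (square G) u v k → ⌈ d /2⌉ ≤ k
    lower q = let _ , ≤k , q′ = unsquare-walk q in ≤-trans (⌈n/2⌉-mono (least q′)) ≤k

-- Cycles

-- Walks in one direction only: without turning back, start and length determine the end modulo `n`.
data Run {n} : Fin n → Fin n → ℕ → Set where
  []  : ∀ {u} → Run u u 0
  _∷_ : ∀ {u v w k} → Follows u v → Run v w k → Run u w (suc k)

-- `q` counts the passages from n - 1 to 0.
run-offset : ∀ {n} {u v : Fin n} {k} → Run u v k → ∃[ q ] toℕ u + k ≡ toℕ v + q * n
run-offset [] = 0 , refl
run-offset {n} {u} {w} (_∷_ {v = v} {k = k} f r) with run-offset r
... | q , v+k≡w+qn with f
... | inj₁ 1+u≡v = q , (begin
        toℕ u + suc k    ≡⟨ +-suc (toℕ u) k ⟩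
        suc (toℕ u) + k  ≡⟨ cong (_+ k) 1+u≡v ⟩
        toℕ v + k        ≡⟨ v+k≡w+qn ⟩
        toℕ w + q * n    ∎)
  where open ≡-Reasoning
... | inj₂ (1+u≡n , v≡0) = suc q , (begin
        toℕ u + suc k          ≡⟨ +-suc (toℕ u) k ⟩
        suc (toℕ u) + k        ≡⟨ cong₂ _+_ 1+u≡n (trans (cong (_+ k) (sym v≡0)) v+k≡w+qn) ⟩
        n + (toℕ w + q * n)    ≡⟨ solve 3 (λ a b c → a :+ (b :+ c) := b :+ (a :+ c)) refl n (toℕ w) (q * n) ⟩
        toℕ w + (n + q * n)    ∎)
  where open ≡-Reasoning
        open +-*-Solver

-- A closed run has length divisible by `n`, impossible for a positive length below `n`.
run⇒≢ : ∀ {n} {u v : Fin n} {k} → suc k < n → Run u v (suc k) → u ≢ v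
run⇒≢ {n} {u} 1+k<n r refl =
  let q , u+1+k≡u+qn = run-offset r
  in >⇒∤ 1+k<n (subst (n ∣_) (sym (+-cancelˡ-≡ (toℕ u) _ _ u+1+k≡u+qn)) (divides-refl q))

next : ∀ {n} (u : Fin n) → ∃ (Follows u)
next {suc n} u with suc (toℕ u) <? suc n
... | yes 1+u<n = fromℕ< 1+u<n , inj₁ (sym (toℕ-fromℕ< 1+u<n))
... | no  1+u≮n = zero , inj₂ (≤-antisym (toℕ<n u) (≮⇒≥ 1+u≮n) , refl)

previous : ∀ {n} (v : Fin n) → ∃ λ u → Follows u v
previous {suc n} zero    = Fin.fromℕ n , inj₂ (cong suc (toℕ-fromℕ n) , refl)
previous {suc n} (suc v) = Fin.inject₁ v , inj₁ (cong suc (toℕ-inject₁ v))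

-- The alternatives are no passage through 0 and one passage. Once the passage is made, the rest of
-- the run falls under the first.
run : ∀ {n} {u v : Fin n} k → toℕ u + k ≡ toℕ v ⊎ toℕ u + k ≡ toℕ v + n → Run u v k
run {u = u} zero (inj₁ u+0≡v) with toℕ-injective (trans (sym (+-identityʳ (toℕ u))) u+0≡v)
... | refl = []
run {n} {u} {v} zero (inj₂ u+0≡v+n) = contradiction
  (subst (_< n) (trans (sym (+-identityʳ (toℕ u))) u+0≡v+n) (toℕ<n u))
  (≤⇒≯ (m≤n+m n (toℕ v)))
run {n} {u} {v} (suc k) eq with next u
... | u′ , f@(inj₁ 1+u≡u′) = f ∷ run k (Sum.map (trans step) (trans step) eq)
  where
  step : toℕ u′ + k ≡ toℕ u + suc k
  step = trans (cong (_+ k) (sym 1+u≡u′)) (sym (+-suc (toℕ u) k))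
... | u′ , f@(inj₂ (1+u≡n , u′≡0)) = f ∷ run k (inj₁ (u′+k≡v eq))
  where
  n+k≡u+1+k : n + k ≡ toℕ u + suc k
  n+k≡u+1+k = trans (cong (_+ k) (sym 1+u≡n)) (sym (+-suc (toℕ u) k))

  u′+k≡v : toℕ u + suc k ≡ toℕ v ⊎ toℕ u + suc k ≡ toℕ v + n → toℕ u′ + k ≡ toℕ v
  u′+k≡v (inj₁ u+1+k≡v) = contradiction
    (subst (_< n) (trans (sym u+1+k≡v) (sym n+k≡u+1+k)) (toℕ<n v)) (≤⇒≯ (m≤m+n n k))
  u′+k≡v (inj₂ u+1+k≡v+n) = trans (cong (_+ k) u′≡0)
    (+-cancelˡ-≡ n _ _ (trans n+k≡u+1+k (trans u+1+k≡v+n (+-comm (toℕ v) n))))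

-- Arcs and distances in the cycle

arc : ℕ → ℕ → ℕ → ℕ
arc n u w = ∣ u - w ∣ ⊓ (n ∸ ∣ u - w ∣)

∣m-n∣≤1+∣1+m-n∣ : ∀ m n → ∣ m - n ∣ ≤ suc ∣ suc m - n ∣
∣m-n∣≤1+∣1+m-n∣ zero    zero    = z≤n
∣m-n∣≤1+∣1+m-n∣ zero    (suc n) = ≤-refl
∣m-n∣≤1+∣1+m-n∣ (suc m) zero    = ≤-trans (n≤1+n _) (n≤1+n _)
∣m-n∣≤1+∣1+m-n∣ (suc m) (suc n) = ∣m-n∣≤1+∣1+m-n∣ m n

∣1+m-n∣≤1+∣m-n∣ : ∀ m n → ∣ suc m - n ∣ ≤ suc ∣ m - n ∣
∣1+m-n∣≤1+∣m-n∣ zero    zero    = ≤-refl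
∣1+m-n∣≤1+∣m-n∣ zero    (suc n) = ≤-trans (n≤1+n _) (n≤1+n _)
∣1+m-n∣≤1+∣m-n∣ (suc m) zero    = ≤-refl
∣1+m-n∣≤1+∣m-n∣ (suc m) (suc n) = ∣1+m-n∣≤1+∣m-n∣ m n

-- The arc between two vertices at offset d, or its complement, has length at most k.
ArcBound : ℕ → ℕ → ℕ → Set
ArcBound n k d = d ≤ k ⊎ n ≤ d + k

-- Covers a step between consecutive numbers, which changes the offset by at most one.
arcBound-suc : ∀ {n k d e} → d ≤ suc e → e ≤ suc d → ArcBound n k e → ArcBound n (suc k) d
arcBound-suc {k = k} {d} d≤1+e e≤1+d = Sum.map
  (λ e≤k → ≤-trans d≤1+e (s≤s e≤k))
  (λ n≤e+k → ≤-trans n≤e+k (≤-trans (+-monoˡ-≤ k e≤1+d) (≤-reflexive (sym (+-suc d k)))))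

-- Covers the step between n - 1 and 0: the offsets before and after it add up to n - 1, so the two
-- alternatives of `ArcBound` change places.
arcBound-wrap : ∀ {n k d e} → e + suc d ≡ n → ArcBound n k e → ArcBound n (suc k) d
arcBound-wrap {n} {k} {d} {e} refl (inj₁ e≤k) = inj₂ (begin
  e + suc d  ≡⟨ +-comm e (suc d) ⟩
  suc d + e  ≤⟨ +-monoʳ-≤ (suc d) e≤k ⟩
  suc d + k  ≡⟨ +-suc d k ⟨
  d + suc k  ∎)
  where open ≤-Reasoning
arcBound-wrap {e = e} refl (inj₂ e+1+d≤e+k) =
  inj₁ (m≤n⇒m≤1+n (≤-trans (n≤1+n _) (+-cancelˡ-≤ e _ _ e+1+d≤e+k)))

-- For vertices `m ≤ n` of a cycle of order `o`: going on from `n` along the complementary arc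
-- reaches `m` after one passage through 0, in the form that `run` expects.
complement : ∀ {m n o} → m ≤ n → n ≤ o → n + (o ∸ (n ∸ m)) ≡ m + o
complement {m} {n} {o} m≤n n≤o = begin
  n + (o ∸ (n ∸ m))              ≡⟨ cong (_+ (o ∸ (n ∸ m))) (m+[n∸m]≡n m≤n) ⟨
  m + (n ∸ m) + (o ∸ (n ∸ m))    ≡⟨ +-assoc m (n ∸ m) _ ⟩
  m + (n ∸ m + (o ∸ (n ∸ m)))    ≡⟨ cong (m +_) (m+[n∸m]≡n (≤-trans (m∸n≤m n m) n≤o)) ⟩
  m + o                          ∎
  where open ≡-Reasoning

1+w+∣last-w∣≡n : ∀ {n} u w → w < n → suc u ≡ n → suc w + ∣ u - w ∣ ≡ n
1+w+∣last-w∣≡n u w w<1+u refl = cong suc (begin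
  w + ∣ u - w ∣  ≡⟨ cong (w +_) (m≤n⇒∣n-m∣≡n∸m (s≤s⁻¹ w<1+u)) ⟩
  w + (u ∸ w)    ≡⟨ m+[n∸m]≡n (s≤s⁻¹ w<1+u) ⟩
  u              ∎)
  where open ≡-Reasoning

module _ {n : ℕ} (3≤n : 3 ≤ n) where

  private C = cycle n 3≤n

  run⇒walk : ∀ {u v k} → Run u v k → Walk C u v k
  run⇒walk []      = []
  run⇒walk (f ∷ r) = inj₁ f ∷ run⇒walk r

  arcBound-step : ∀ w {u v k} → Adj C u v →
                  ArcBound n k ∣ toℕ v - toℕ w ∣ → ArcBound n (suc k) ∣ toℕ u - toℕ w ∣
  arcBound-step w {u} {v} (inj₁ (inj₁ 1+u≡v)) rewrite sym 1+u≡v =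
    arcBound-suc (∣m-n∣≤1+∣1+m-n∣ (toℕ u) (toℕ w)) (∣1+m-n∣≤1+∣m-n∣ (toℕ u) (toℕ w))
  arcBound-step w {u} {v} (inj₂ (inj₁ 1+v≡u)) rewrite sym 1+v≡u =
    arcBound-suc (∣1+m-n∣≤1+∣m-n∣ (toℕ v) (toℕ w)) (∣m-n∣≤1+∣1+m-n∣ (toℕ v) (toℕ w))
  arcBound-step w {u} {v} (inj₁ (inj₂ (1+u≡n , v≡0))) rewrite v≡0 =
    arcBound-wrap (trans (+-suc (toℕ w) _) (1+w+∣last-w∣≡n (toℕ u) (toℕ w) (toℕ<n w) 1+u≡n))
  arcBound-step w {u} {v} (inj₂ (inj₂ (1+v≡n , u≡0))) rewrite u≡0 =
    arcBound-wrap (trans (+-comm _ (suc (toℕ w))) (1+w+∣last-w∣≡n (toℕ v) (toℕ w) (toℕ<n w) 1+v≡n))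

  arcBound : ∀ {u w k} → Walk C u w k → ArcBound n k ∣ toℕ u - toℕ w ∣
  arcBound {w = w} []      = inj₁ (≤-reflexive (∣n-n∣≡0 (toℕ w)))
  arcBound {w = w} (a ∷ p) = arcBound-step w a (arcBound p)

  arc-walks : ∀ u w → Walk C u w ∣ toℕ u - toℕ w ∣ × Walk C u w (n ∸ ∣ toℕ u - toℕ w ∣)
  arc-walks u w with ≤-total (toℕ u) (toℕ w)
  ... | inj₁ u≤w rewrite m≤n⇒∣m-n∣≡n∸m u≤w =
    run⇒walk (run _ (inj₁ (m+[n∸m]≡n u≤w))) ,
    reverse C (run⇒walk (run _ (inj₂ (complement u≤w (<⇒≤ (toℕ<n w))))))
  ... | inj₂ w≤u rewrite m≤n⇒∣n-m∣≡n∸m w≤u =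
    reverse C (run⇒walk (run _ (inj₁ (m+[n∸m]≡n w≤u)))) ,
    run⇒walk (run _ (inj₂ (complement w≤u (<⇒≤ (toℕ<n u)))))

  -- Both arcs are walks by `arc-walks`, and `arcBound` makes every walk at least as long as one of
  -- them.
  cycle-distance : ∀ u w → Distance C u w (just (arc n (toℕ u) (toℕ w)))
  cycle-distance u w = finite (walk , least ∘ arcBound)
    where
    d : ℕ
    d = ∣ toℕ u - toℕ w ∣

    walk : Walk C u w (arc n (toℕ u) (toℕ w))
    walk with ⊓-sel d (n ∸ d)
    ... | inj₁ eq = subst (Walk C u w) (sym eq) (proj₁ (arc-walks u w))
    ... | inj₂ eq = subst (Walk C u w) (sym eq) (proj₂ (arc-walks u w))

    least : ∀ {k} → ArcBound n k d → d ⊓ (n ∸ d) ≤ k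
    least (inj₁ d≤k)   = ≤-trans (m⊓n≤m d (n ∸ d)) d≤k
    least (inj₂ n≤d+k) = ≤-trans (m⊓n≤n d (n ∸ d)) (m≤n+o⇒m∸n≤o n d n≤d+k)

  cycle²-neighbours : 5 ≤ n → ∀ a → ∃[ vs ] (Unique {n = 4} vs × All (Adj (square C) a) vs)
  cycle²-neighbours 5≤n a =
    -- `b`, `c`, `a`, `d`, `e` are consecutive on the cycle, and the runs joining two of them have
    -- length at most 4, less than `n`; hence the four neighbours are distinct.
    let c , f₂ = previous a
        b , f₁ = previous c
        d , f₃ = next a
        e , f₄ = next d
        r₁ = f₂ ∷ []
        r₂ = f₁ ∷ f₂ ∷ []
        r₃ = f₃ ∷ []
        r₄ = f₃ ∷ f₄ ∷ []
    in b ∷ c ∷ d ∷ e ∷ [] ,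
       ((run⇒≢ 2≤n (f₁ ∷ []) ∷ run⇒≢ 4≤n (f₁ ∷ f₂ ∷ f₃ ∷ []) ∷ run⇒≢ 5≤n (f₁ ∷ f₂ ∷ f₃ ∷ f₄ ∷ []) ∷ []) ∷
        (run⇒≢ 3≤n (f₂ ∷ f₃ ∷ []) ∷ run⇒≢ 4≤n (f₂ ∷ f₃ ∷ f₄ ∷ []) ∷ []) ∷
        (run⇒≢ 2≤n (f₄ ∷ []) ∷ []) ∷ [] ∷ []) ,
       backward ≤-refl 3≤n r₂ ∷ backward 1≤2 2≤n r₁ ∷
       forward 1≤2 2≤n r₃ ∷ forward ≤-refl 3≤n r₄ ∷ []
    where
    1≤2 : 1 ≤ 2
    1≤2 = s≤s z≤n

    4≤n : 4 ≤ n
    4≤n = ≤-trans (n≤1+n 4) 5≤n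

    2≤n : 2 ≤ n
    2≤n = ≤-trans (n≤1+n 2) 3≤n

    forward : ∀ {u v k} → suc k ≤ 2 → suc k < n → Run u v (suc k) → Adj (square C) u v
    forward 1+k≤2 1+k<n r = walk≤2⇒square-adj C (run⇒≢ 1+k<n r) 1+k≤2 (run⇒walk r)

    backward : ∀ {u v k} → suc k ≤ 2 → suc k < n → Run u v (suc k) → Adj (square C) v u
    backward 1+k≤2 1+k<n r = Graph.symm (square C) (forward 1+k≤2 1+k<n r)

-- The resolving set {0, 1, 2}

-- The constructors stand for p < q, p = q and p > q. The first field tells the case from `c₀` and
-- `c₂` alone; the others record what the distances then reveal about `x` and `y`.
data Profile (c₀ c₁ c₂ x y : ℕ) : Set where
  left   : c₀ ≡ suc c₂ → ⌈ x /2⌉ ≡ c₂ → ⌈ suc x /2⌉ ≡ c₁ → Profile c₀ c₁ c₂ x y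
  middle : c₀ ≡ c₂ → ⌈ x /2⌉ ≡ c₀ → ⌈ y /2⌉ ≡ c₀ → Profile c₀ c₁ c₂ x y
  right  : suc c₀ ≡ c₂ → ⌈ y /2⌉ ≡ c₀ → ⌈ suc y /2⌉ ≡ c₁ → Profile c₀ c₁ c₂ x y

⌈1+n/2⌉≤1+⌈n/2⌉ : ∀ n → ⌈ suc n /2⌉ ≤ suc ⌈ n /2⌉
⌈1+n/2⌉≤1+⌈n/2⌉ n = ⌈n/2⌉-mono (n≤1+n (suc n))

-- If p < q, then ⌈(x+1)/2⌉ ≤ p + 1 ≤ q ≤ ⌈(y+1)/2⌉, so all three minima are attained on the side of
-- `x`; p > q is symmetric.
profile : ∀ {c₀ c₁ c₂} x y → suc ⌈ x /2⌉ ⊓ ⌈ y /2⌉ ≡ c₀ → ⌈ suc x /2⌉ ⊓ ⌈ suc y /2⌉ ≡ c₁ →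
          ⌈ x /2⌉ ⊓ suc ⌈ y /2⌉ ≡ c₂ → Profile c₀ c₁ c₂ x y
profile x y refl refl refl with <-cmp ⌈ x /2⌉ ⌈ y /2⌉
... | tri< p<q _ _ =
  left (trans (m≤n⇒m⊓n≡m p<q) (cong suc (sym p⊓1+q))) (sym p⊓1+q)
       (sym (m≤n⇒m⊓n≡m (≤-trans (⌈1+n/2⌉≤1+⌈n/2⌉ x) (≤-trans p<q (⌈n/2⌉-mono (n≤1+n y))))))
  where p⊓1+q = m≤n⇒m⊓n≡m (≤-trans (<⇒≤ p<q) (n≤1+n ⌈ y /2⌉))
... | tri≈ _ p≡q _ rewrite p≡q =
  middle (trans 1+q⊓q (sym q⊓1+q)) (trans p≡q (sym 1+q⊓q)) (sym 1+q⊓q)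
  where 1+q⊓q = m≥n⇒m⊓n≡n (n≤1+n ⌈ y /2⌉)
        q⊓1+q = m≤n⇒m⊓n≡m (n≤1+n ⌈ y /2⌉)
... | tri> _ _ q<p =
  right (trans (cong suc 1+p⊓q) (sym (m≥n⇒m⊓n≡n q<p))) (sym 1+p⊓q)
        (sym (m≥n⇒m⊓n≡n (≤-trans (⌈1+n/2⌉≤1+⌈n/2⌉ y) (≤-trans q<p (⌈n/2⌉-mono (n≤1+n x))))))
  where 1+p⊓q = m≥n⇒m⊓n≡n (≤-trans (<⇒≤ q<p) (n≤1+n ⌈ x /2⌉))

⌈n/2⌉+⌈1+n/2⌉≡1+n : ∀ n → ⌈ n /2⌉ + ⌈ suc n /2⌉ ≡ suc n
⌈n/2⌉+⌈1+n/2⌉≡1+n n = ⌊n/2⌋+⌈n/2⌉≡n (suc n)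

-- The two halves add up to `suc m`.
⌈/2⌉-pair-injective : ∀ {c d} m n → ⌈ m /2⌉ ≡ c → ⌈ suc m /2⌉ ≡ d →
                      ⌈ n /2⌉ ≡ c → ⌈ suc n /2⌉ ≡ d → m ≡ n
⌈/2⌉-pair-injective m n refl refl n≡c n≡d = suc-injective
  (trans (sym (⌈n/2⌉+⌈1+n/2⌉≡1+n m))
    (trans (sym (cong₂ _+_ n≡c n≡d)) (⌈n/2⌉+⌈1+n/2⌉≡1+n n)))

-- The fibre of `⌈_/2⌉` over a positive `c` is {2c - 1, 2c}, so two distinct members are these in
-- order.
⌈/2⌉-fibre : ∀ {c} m n → m < n → ⌈ m /2⌉ ≡ c → ⌈ n /2⌉ ≡ c → suc m ≡ c + c × n ≡ c + c
⌈/2⌉-fibre {c} m n m<n refl n≡c = 1+m≡ , ≤-antisym n≤ (≤-trans (≤-reflexive (sym 1+m≡)) m<n)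
  where
  1+m≡ : suc m ≡ ⌈ m /2⌉ + ⌈ m /2⌉
  1+m≡ = trans (sym (⌈n/2⌉+⌈1+n/2⌉≡1+n m)) (cong (⌈ m /2⌉ +_)
    (≤-antisym (≤-trans (⌈n/2⌉-mono m<n) (≤-reflexive n≡c)) (⌈n/2⌉-mono (n≤1+n m))))

  n≤ : n ≤ ⌈ m /2⌉ + ⌈ m /2⌉
  n≤ = subst (λ c → n ≤ c + c) n≡c
    (≤-trans (≤-reflexive (sym (⌊n/2⌋+⌈n/2⌉≡n n))) (+-monoˡ-≤ ⌈ n /2⌉ (⌊n/2⌋≤⌈n/2⌉ n)))

-- Equal sums force y′ < y, so the fibres give x = 2c - 1 and y = 2c.
middle-collision : ∀ {c} x y x′ y′ → x + y ≡ x′ + y′ → x < x′ →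
                   ⌈ x /2⌉ ≡ c → ⌈ x′ /2⌉ ≡ c → ⌈ y /2⌉ ≡ c → ⌈ y′ /2⌉ ≡ c →
                   2 + x + y ≡ 1 + c * 4
middle-collision {c} x y x′ y′ eq x<x′ hx hx′ hy hy′ = begin
  2 + x + y          ≡⟨ cong suc (cong₂ _+_ (proj₁ (⌈/2⌉-fibre x x′ x<x′ hx hx′))
                                            (proj₂ (⌈/2⌉-fibre y′ y y′<y hy′ hy))) ⟩
  1 + (c + c + (c + c)) ≡⟨ solve 1 (λ c → con 1 :+ (c :+ c :+ (c :+ c)) := con 1 :+ c :* con 4) refl c ⟩
  1 + c * 4          ∎
  where
  open ≡-Reasoning
  open +-*-Solver
  y′<y : y′ < y
  y′<y = ≰⇒> λ y≤y′ → <⇒≢ (+-mono-<-≤ x<x′ y≤y′) eq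

profile-injective : ∀ {n c₀ c₁ c₂} x y x′ y′ → n % 4 ≢ 1 → 2 + x + y ≡ n → 2 + x′ + y′ ≡ n →
                    Profile c₀ c₁ c₂ x y → Profile c₀ c₁ c₂ x′ y′ → x ≡ x′
profile-injective {c₁ = c₁} x y x′ y′ n%4≢1 refl eq′ = go
  where
  eq : x + y ≡ x′ + y′
  eq = +-cancelˡ-≡ 2 _ _ (sym eq′)

  n≢1+4c : ∀ c → 2 + x + y ≢ 1 + c * 4
  n≢1+4c c n≡1+4c = n%4≢1 (trans (cong (_% 4) n≡1+4c) ([m+kn]%n≡m%n 1 c 4))

  go : ∀ {c₀ c₂} → Profile c₀ c₁ c₂ x y → Profile c₀ c₁ c₂ x′ y′ → x ≡ x′
  go (left _ p r)    (left _ p′ r′)   = ⌈/2⌉-pair-injective x x′ p r p′ r′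
  go (right _ p r)   (right _ p′ r′)  = +-cancelʳ-≡ y x x′
    (trans eq (cong (x′ +_) (sym (⌈/2⌉-pair-injective y y′ p r p′ r′))))
  go {c₀} (middle _ p q) (middle _ p′ q′) with <-cmp x x′
  ... | tri< x<x′ _ _ = contradiction (middle-collision x y x′ y′ eq x<x′ p p′ q q′) (n≢1+4c c₀)
  ... | tri≈ _ x≡x′ _ = x≡x′
  ... | tri> _ _ x′<x = contradiction
    (trans (cong (2 +_) eq) (middle-collision x′ y′ x y (sym eq) x′<x p′ p q′ q)) (n≢1+4c c₀)
  -- Since `c₀` minus `c₂` is 1, 0 or -1 according to the constructor, a mismatch would make a
  -- number equal to a proper successor of itself.
  go (left refl _ _)   (middle () _ _)
  go (left refl _ _)   (right () _ _)
  go (middle refl _ _) (left () _ _)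
  go (middle refl _ _) (right () _ _)
  go (right refl _ _)  (left () _ _)
  go (right refl _ _)  (middle () _ _)

-- For `u` and `w` below `n`, this is their distance in the square of the cycle.
code : ℕ → ℕ → ℕ → ℕ
code n u w = ⌈ arc n u w /2⌉

⌈arc/2⌉ : ∀ {n s t} → s + t ≡ n → ⌈ s ⊓ (n ∸ s) /2⌉ ≡ ⌈ s /2⌉ ⊓ ⌈ t /2⌉
⌈arc/2⌉ {s = s} {t} refl rewrite m+n∸m≡n s t = mono-≤-distrib-⊓ ⌈n/2⌉-mono s t

-- The arcs from 2 + x to 0, 1, 2 have lengths 2 + x and y, 1 + x and 1 + y, x and 2 + y.
code-profile : ∀ {n} x y → 2 + x + y ≡ n →
               Profile (code n (2 + x) 0) (code n (2 + x) 1) (code n (2 + x) 2) x y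
code-profile {n} x y eq = profile x y
  (sym (⌈arc/2⌉ eq))
  (sym (⌈arc/2⌉ (trans (cong suc (+-suc x y)) eq)))
  (sym (trans (cong (λ d → ⌈ d ⊓ (n ∸ d) /2⌉) (∣-∣-identityʳ x))
              (⌈arc/2⌉ (trans (trans (+-suc x (suc y)) (cong suc (+-suc x y))) eq))))

-- Between distinct vertices both arcs are positive, and halving with rounding up keeps them so.
code≡0⇒≡ : ∀ {n u w} → u < n → w < n → code n u w ≡ 0 → u ≡ w
code≡0⇒≡ {n} {u} {w} u<n w<n eq =
  ∣m-n∣≡0⇒m≡n (zero-arc ∣ u - w ∣ (≤-<-trans (∣m-n∣≤m⊔n u w) (⊔-pres-<m u<n w<n)) eq)
  where
  zero-arc : ∀ d → d < n → ⌈ d ⊓ (n ∸ d) /2⌉ ≡ 0 → d ≡ 0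
  zero-arc zero    _   _  = refl
  zero-arc (suc d) d<n eq with n ∸ suc d | m<n⇒0<n∸m d<n
  zero-arc (suc d) d<n () | suc _ | _

code-refl : ∀ n u → code n u u ≡ 0
code-refl n u rewrite ∣n-n∣≡0 u = refl

-- Vertices 0 and 1 are recognised by a zero code; all others, 2 included, have the form 2 + x and
-- are compared by profiles.
code-injective : ∀ {n} u v → n % 4 ≢ 1 → u < n → v < n →
                 code n u 0 ≡ code n v 0 → code n u 1 ≡ code n v 1 → code n u 2 ≡ code n v 2 → u ≡ v
code-injective {n} 0 v _ u<n v<n c₀ _ _ = sym (code≡0⇒≡ v<n u<n (trans (sym c₀) (code-refl n 0)))
code-injective {n} 1 v _ u<n v<n _ c₁ _ = sym (code≡0⇒≡ v<n u<n (trans (sym c₁) (code-refl n 1)))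
code-injective {n} u@(suc (suc _)) 0 _ u<n v<n c₀ _ _ = code≡0⇒≡ u<n v<n (trans c₀ (code-refl n 0))
code-injective {n} u@(suc (suc _)) 1 _ u<n v<n _ c₁ _ = code≡0⇒≡ u<n v<n (trans c₁ (code-refl n 1))
code-injective {n} (suc (suc x)) (suc (suc x′)) n%4≢1 u<n v<n c₀ c₁ c₂ = cong (2 +_)
  (profile-injective x (n ∸ (2 + x)) x′ (n ∸ (2 + x′)) n%4≢1 eq eq′ (code-profile x _ eq) profile′)
  where
  eq = m+[n∸m]≡n (<⇒≤ u<n)
  eq′ = m+[n∸m]≡n (<⇒≤ v<n)
  profile′ : Profile (code n (2 + x) 0) (code n (2 + x) 1) (code n (2 + x) 2) x′ (n ∸ (2 + x′))
  -- The codes of `v` replace those of `u`, so that both profiles have the same indices.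
  profile′ rewrite c₀ | c₁ | c₂ = code-profile x′ _ eq′

landmarks : ∀ m → Subset (3 + m)
landmarks m = inside ∷ inside ∷ inside ∷ Subset.⊥

landmarks-resolving : ∀ {m} (3≤n : 3 ≤ 3 + m) → (3 + m) % 4 ≢ 1 →
                      Resolving (square (cycle (3 + m) 3≤n)) (landmarks m)
landmarks-resolving {m} 3≤n n%4≢1 {u} {v} u≢v = resolve (same? 0F) (same? 1F) (same? 2F)
  where
  n : ℕ
  n = 3 + m

  Same : Fin n → Set
  Same w = code n (toℕ u) (toℕ w) ≡ code n (toℕ v) (toℕ w)

  same? : ∀ w → Dec (Same w)
  same? w = code n (toℕ u) (toℕ w) ≟ code n (toℕ v) (toℕ w)

  by : ∀ w → ¬ Same w → Resolves (square (cycle n 3≤n)) w u v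
  by w differ = _ , _ ,
    square-distance _ (cycle-distance 3≤n u w) , square-distance _ (cycle-distance 3≤n v w) ,
    differ ∘ just-injective

  resolve : Dec (Same 0F) → Dec (Same 1F) → Dec (Same 2F) →
            ∃[ w ] (w ∈ landmarks m × Resolves (square (cycle n 3≤n)) w u v)
  resolve (no c₀) _ _ = 0F , here , by 0F c₀
  resolve (yes _) (no c₁) _ = 1F , there here , by 1F c₁
  resolve (yes _) (yes _) (no c₂) = 2F , there (there here) , by 2F c₂
  resolve (yes c₀) (yes c₁) (yes c₂) = contradiction
    (toℕ-injective (code-injective (toℕ u) (toℕ v) n%4≢1 (toℕ<n u) (toℕ<n v) c₀ c₁ c₂)) u≢v

-- Irreducibility and threshold dimension

mainTheorem4 : (n : ℕ) (6≤n : 6 ≤ n) → n % 4 ≢ 1 →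
    let C = cycle n (≤-trans (m≤m+n 3 3) 6≤n) in
    Irreducible (square C) × ThresholdDimension (square C) 3
mainTheorem4 n@(suc (suc (suc m))) 6≤n@(s≤s (s≤s (s≤s _))) n%4≢1 = (3 , threshold , dimension) , threshold
  where
  3≤n : 3 ≤ n
  3≤n = ≤-trans (m≤m+n 3 3) 6≤n

  G : Graph n
  G = square (cycle n 3≤n)

  -- Four neighbours in `G` remain neighbours in every `H` containing it; this one bound serves the
  -- metric dimension, with `H` equal to `G`, and the threshold dimension.
  lower : ∀ H → G ⊆ᴳ H → ∀ {W} → Resolving H W → 3 ≤ ∣ W ∣
  lower H G⊆H = degree≥4⇒resolving≥3 H zero λ a →
    let vs , unique , adjacent = cycle²-neighbours 3≤n (≤-trans (n≤1+n 5) 6≤n) a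
    in vs , unique , All.map G⊆H adjacent

  dimension : MetricDimension G 3
  dimension = (landmarks m , landmarks-resolving 3≤n n%4≢1 , cong (3 +_) (∣⊥∣≡0 m)) ,
    λ { (W , resolving , refl) → lower G id resolving }

  threshold : ThresholdDimension G 3
  threshold = (G , id , dimension) ,
    λ { H G⊆H ((W , resolving , refl) , _) → lower H G⊆H resolving }
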